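{- Let $L$ be a lattice in the variety $\mathcal{N}$ generated by $N_5$, and assume that $L$ is isomorphic to a sublattice of a free lattice. Let $Y$ be an antichain in $L$. If there is an element $d \in L$ such that $a \wedge b = d$ for all distinct $a, b \in Y$, then $|Y| \leq 3$ and at most two elements of $Y$ do not cover $d$ in $L$. Moreover, if there is an element $d \in L$ such that $a \vee b = d$ for all distinct $a, b \in Y$, then $|Y| \leq 3$ and at most two elements of $Y$ are not covered by $d$ in $L$.
   Context: $N_5$ (the pentagon) is the five-element lattice $\{0, x, y, z, 1\}$ with $0 < y < z < 1$, $0 < x < 1$, and $x \parallel y$, $x \parallel z$. $\mathcal{N}$ denotes the variety of lattices generated by $N_5$. For $u<v$ in $L$, $v$ covers $u$ in $L$ if there is no $w \in L$ with $u < w < v$. -}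

module Defs where

open import Level using (Level; _⊔_) renaming (suc to lsuc)
open import Data.Nat using (ℕ)
open import Data.Fin using (Fin)
open import Data.Product using (Σ; ∃; _×_; _,_)
open import Relation.Nullary using (¬_)
open import Relation.Binary.PropositionalEquality using (_≡_)
open import Algebra.Lattice.Bundles using (Lattice)

data Term {a} (X : Set a) : Set a where
  var  : X → Term X
  _∨ₜ_ : Term X → Term X → Term X
  _∧ₜ_ : Term X → Term X → Term X

-- The pentagon N5 = {0, x, y, z, 1}, 0 < y < z < 1, 0 < x < 1,
-- x incomparable with y and z.

data N5 : Set where
  𝟎 x y z 𝟏 : N5

_∨₅_ : N5 → N5 → N5
𝟎 ∨₅ b = b
𝟏 ∨₅ b = 𝟏
x ∨₅ 𝟎 = x
x ∨₅ x = x
x ∨₅ y = 𝟏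
x ∨₅ z = 𝟏
x ∨₅ 𝟏 = 𝟏
y ∨₅ 𝟎 = y
y ∨₅ x = 𝟏
y ∨₅ y = y
y ∨₅ z = z
y ∨₅ 𝟏 = 𝟏
z ∨₅ 𝟎 = z
z ∨₅ x = 𝟏
z ∨₅ y = z
z ∨₅ z = z
z ∨₅ 𝟏 = 𝟏

_∧₅_ : N5 → N5 → N5
𝟎 ∧₅ b = 𝟎
𝟏 ∧₅ b = b
x ∧₅ 𝟎 = 𝟎
x ∧₅ x = x
x ∧₅ y = 𝟎
x ∧₅ z = 𝟎
x ∧₅ 𝟏 = x
y ∧₅ 𝟎 = 𝟎
y ∧₅ x = 𝟎
y ∧₅ y = y
y ∧₅ z = y
y ∧₅ 𝟏 = y
z ∧₅ 𝟎 = 𝟎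
z ∧₅ x = 𝟎
z ∧₅ y = y
z ∧₅ z = z
z ∧₅ 𝟏 = z

eval₅ : (ℕ → N5) → Term ℕ → N5
eval₅ ρ (var i)  = ρ i
eval₅ ρ (s ∨ₜ t) = eval₅ ρ s ∨₅ eval₅ ρ t
eval₅ ρ (s ∧ₜ t) = eval₅ ρ s ∧₅ eval₅ ρ t

N5⊨ : Term ℕ → Term ℕ → Set
N5⊨ s t = (ρ : ℕ → N5) → eval₅ ρ s ≡ eval₅ ρ t

module _ {c ℓ} (L : Lattice c ℓ) where
  open Lattice L

  evalL : (ℕ → Carrier) → Term ℕ → Carrier
  evalL ρ (var i)  = ρ i
  evalL ρ (s ∨ₜ t) = evalL ρ s ∨ evalL ρ t
  evalL ρ (s ∧ₜ t) = evalL ρ s ∧ evalL ρ t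

  -- L lies in the variety 𝒩 generated by N5:
  -- L satisfies every lattice identity satisfied by N5 (Birkhoff).
  InVarietyN5 : Set (c ⊔ ℓ)
  InVarietyN5 = (s t : Term ℕ) → N5⊨ s t → (ρ : ℕ → Carrier) → evalL ρ s ≈ evalL ρ t

  _≤L_ : Carrier → Carrier → Set ℓ
  a ≤L b = (a ∧ b) ≈ a

  _<L_ : Carrier → Carrier → Set ℓ
  a <L b = (a ≤L b) × ¬ (a ≈ b)

  Covers : Carrier → Carrier → Set (c ⊔ ℓ)
  Covers v u = (u <L v) × ¬ (Σ Carrier λ w → (u <L w) × (w <L v))

  module _ {p} (Y : Carrier → Set p) where
    Antichain : Set (c ⊔ ℓ ⊔ p)
    Antichain = ∀ a b → Y a → Y b → a ≤L b → a ≈ b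

    HasDistinct : ℕ → Set (c ⊔ ℓ ⊔ p)
    HasDistinct n = Σ (Fin n → Carrier) λ f →
      ((i : Fin n) → Y (f i)) × ((i j : Fin n) → f i ≈ f j → i ≡ j)

  AtMost : ∀ {p} → ℕ → (Carrier → Set p) → Set (c ⊔ ℓ ⊔ p)
  AtMost n Y = ¬ HasDistinct Y (ℕ.suc n)

-- The free lattice FL(X): lattice terms over X modulo the equivalence
-- generated by the lattice axioms (a setoid presentation of the quotient).

module _ {a} {X : Set a} where
  infix 4 _~_
  data _~_ : Term X → Term X → Set a where
    ~refl  : ∀ {s} → s ~ s
    ~sym   : ∀ {s t} → s ~ t → t ~ s
    ~trans : ∀ {s t u} → s ~ t → t ~ u → s ~ u
    ∨-cong : ∀ {s s' t t'} → s ~ s' → t ~ t' → (s ∨ₜ t) ~ (s' ∨ₜ t')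
    ∧-cong : ∀ {s s' t t'} → s ~ s' → t ~ t' → (s ∧ₜ t) ~ (s' ∧ₜ t')
    ∨-comm : ∀ s t → (s ∨ₜ t) ~ (t ∨ₜ s)
    ∧-comm : ∀ s t → (s ∧ₜ t) ~ (t ∧ₜ s)
    ∨-assoc : ∀ s t u → ((s ∨ₜ t) ∨ₜ u) ~ (s ∨ₜ (t ∨ₜ u))
    ∧-assoc : ∀ s t u → ((s ∧ₜ t) ∧ₜ u) ~ (s ∧ₜ (t ∧ₜ u))
    ∨-absorbs-∧ : ∀ s t → (s ∨ₜ (s ∧ₜ t)) ~ s
    ∧-absorbs-∨ : ∀ s t → (s ∧ₜ (s ∨ₜ t)) ~ s

module _ {c ℓ} (L : Lattice c ℓ) where
  open Lattice L

  record EmbedsInto (X : Set c) : Set (c ⊔ ℓ) where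
    field
      h      : Carrier → Term X
      h-cong : ∀ {a b} → a ≈ b → h a ~ h b
      h-∨    : ∀ a b → h (a ∨ b) ~ (h a ∨ₜ h b)
      h-∧    : ∀ a b → h (a ∧ b) ~ (h a ∧ₜ h b)
      h-inj  : ∀ {a b} → h a ~ h b → a ≈ b

  SublatticeOfFree : Set (lsuc c ⊔ ℓ)
  SublatticeOfFree = Σ (Set c) λ X → EmbedsInto X

{-# OPTIONS --safe #-}
-- A sublattice of a free lattice satisfies Whitman's condition (W), and a
-- lattice in 𝒩 satisfies every inequality that can be verified in N5; nothing
-- else about L is used.  Suppose elements a, b, c, e have pairwise meets d.
-- The inequalities of N5 give a ∧ (b ∨ c) = d (semidistributivity) and
-- (a ∨ b) ∧ (a ∨ c) = a.  Applied to u = a ∨ b, c, e, the latter says that u is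
-- both a proper join and a proper meet, against (W).  So |Y| ≤ 3.
--
-- Now let d < a' < a, d < b' < b, d < c' < c.  An inequality of N5 and (W) show
-- that of any two of these elements one, say b, is absorbed by the other:
-- b ≤ b' ∨ a.  If c is absorbed by both a and b, then
-- c ≤ (c' ∨ a) ∧ (c' ∨ b) = c'.  Otherwise absorption is cyclic, say a ≤ a' ∨ c,
-- c ≤ c' ∨ b, and then (a ∨ b) ∧ (a ∨ c) = a ≤ a' ∨ c' violates (W).
--
-- Both (W) and 𝒩 are self-dual, which yields the statement on joins.
module Submission where

open import Defs
open import Level using (_⊔_)
open import Algebra.Lattice.Bundles using (Lattice)
import Algebra.Lattice.Properties.Lattice as LatticeProperties
open import Data.Empty using (⊥)
open import Data.Fin using (#_)
open import Data.Nat using (ℕ; zero; suc)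
import Data.Nat as ℕ
open import Data.Product using (Σ; _×_; _,_; proj₁; proj₂)
open import Data.Sum using (_⊎_; inj₁; inj₂)
import Data.Sum as Sum
open import Data.Vec using (Vec; []; _∷_)
import Relation.Binary.Lattice as Order
import Relation.Binary.Lattice.Properties.JoinSemilattice as JoinSemilatticeProperties
import Relation.Binary.Lattice.Properties.MeetSemilattice as MeetSemilatticeProperties
open import Relation.Binary.PropositionalEquality using (_≡_; refl; sym; trans; cong; cong₂)
open import Relation.Nullary using (¬_; Dec)
open import Relation.Nullary.Decidable using (toWitness; map′; _×-dec_)
open import Relation.Nullary.Negation using (contradiction)

-- The lattice order and Whitman's condition

module LatticeOrder {c ℓ} (L : Lattice c ℓ) where
  open LatticeProperties L using (∨-∧-orderTheoreticLattice)
  -- Here `a ≤ b` unfolds to `a ≈ a ∧ b`, the mirror image of `_≤L_`; symmetry of `_≈_` exchanges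
  -- the two.
  open Order.Lattice ∨-∧-orderTheoreticLattice public
    using (_≤_; antisym; x≤x∨y; y≤x∨y; ∨-least; x∧y≤x; x∧y≤y; ∧-greatest;
           joinSemilattice; meetSemilattice)
    renaming (refl to ≤-refl; trans to ≤-trans; reflexive to ≤-reflexive)
  open JoinSemilatticeProperties joinSemilattice public using (∨-monotonic)
  open MeetSemilatticeProperties meetSemilattice public using (∧-monotonic)

WhitmanCondition : ∀ {c ℓ} → Lattice c ℓ → Set (c ⊔ ℓ)
WhitmanCondition L = ∀ a b p q → a ∧ b ≤ p ∨ q →
  (a ≤ p ∨ q ⊎ b ≤ p ∨ q) ⊎ (a ∧ b ≤ p ⊎ a ∧ b ≤ q)
  where
  open Lattice L using (_∧_; _∨_)
  open LatticeOrder L using (_≤_)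

-- Free lattices

freeLattice : ∀ {a} → Set a → Lattice a a
freeLattice X = record
  { Carrier   = Term X
  ; _≈_       = _~_
  ; _∨_       = _∨ₜ_
  ; _∧_       = _∧ₜ_
  ; isLattice = record
    { isEquivalence = record { refl = ~refl ; sym = ~sym ; trans = ~trans }
    ; ∨-comm        = ∨-comm
    ; ∨-assoc       = ∨-assoc
    ; ∨-cong        = ∨-cong
    ; ∧-comm        = ∧-comm
    ; ∧-assoc       = ∧-assoc
    ; ∧-cong        = ∧-cong
    ; absorptive    = ∨-absorbs-∧ , ∧-absorbs-∨
    }
  }

module _ {a} {X : Set a} where

  -- Whitman's solution of the word problem as a cut-free sequent calculus: (W)
  -- is read off the last rule of a derivation.
  infix 4 _⊑_
  data _⊑_ : Term X → Term X → Set a where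
    ⊑-var : ∀ {i} → var i ⊑ var i
    ∨L    : ∀ {s t u} → s ⊑ u → t ⊑ u → s ∨ₜ t ⊑ u
    ∨R₁   : ∀ {s t u} → s ⊑ t → s ⊑ t ∨ₜ u
    ∨R₂   : ∀ {s t u} → s ⊑ u → s ⊑ t ∨ₜ u
    ∧L₁   : ∀ {s t u} → s ⊑ u → s ∧ₜ t ⊑ u
    ∧L₂   : ∀ {s t u} → t ⊑ u → s ∧ₜ t ⊑ u
    ∧R    : ∀ {s t u} → s ⊑ t → s ⊑ u → s ⊑ t ∧ₜ u

  ⊑-refl : ∀ s → s ⊑ s
  ⊑-refl (var i)  = ⊑-var
  ⊑-refl (s ∨ₜ t) = ∨L (∨R₁ (⊑-refl s)) (∨R₂ (⊑-refl t))
  ⊑-refl (s ∧ₜ t) = ∧R (∧L₁ (⊑-refl s)) (∧L₂ (⊑-refl t))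

  -- Cut elimination. Left rules of the first derivation and right rules of the second permute past
  -- the cut; what remains are principal cuts, which reduce to a component of `t`.
  ⊑-trans : ∀ {s t u} → s ⊑ t → t ⊑ u → s ⊑ u
  ⊑-trans ⊑-var    q          = q
  ⊑-trans (∨L p r) q          = ∨L (⊑-trans p q) (⊑-trans r q)
  ⊑-trans (∧L₁ p)  q          = ∧L₁ (⊑-trans p q)
  ⊑-trans (∧L₂ p)  q          = ∧L₂ (⊑-trans p q)
  ⊑-trans p        (∨R₁ q)    = ∨R₁ (⊑-trans p q)
  ⊑-trans p        (∨R₂ q)    = ∨R₂ (⊑-trans p q)
  ⊑-trans p        (∧R q r)   = ∧R (⊑-trans p q) (⊑-trans p r)
  ⊑-trans (∨R₁ p)  (∨L q _)   = ⊑-trans p q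
  ⊑-trans (∨R₂ p)  (∨L _ q)   = ⊑-trans p q
  ⊑-trans (∧R p _) (∧L₁ q)    = ⊑-trans p q
  ⊑-trans (∧R _ p) (∧L₂ q)    = ⊑-trans p q

  mutual
    ~⇒⊑ : ∀ {s t} → s ~ t → s ⊑ t
    ~⇒⊑ ~refl             = ⊑-refl _
    ~⇒⊑ (~sym e)          = ~⇒⊒ e
    ~⇒⊑ (~trans e f)      = ⊑-trans (~⇒⊑ e) (~⇒⊑ f)
    ~⇒⊑ (∨-cong e f)      = ∨L (∨R₁ (~⇒⊑ e)) (∨R₂ (~⇒⊑ f))
    ~⇒⊑ (∧-cong e f)      = ∧R (∧L₁ (~⇒⊑ e)) (∧L₂ (~⇒⊑ f))
    ~⇒⊑ (∨-comm s t)      = ∨L (∨R₂ (⊑-refl s)) (∨R₁ (⊑-refl t))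
    ~⇒⊑ (∧-comm s t)      = ∧R (∧L₂ (⊑-refl t)) (∧L₁ (⊑-refl s))
    ~⇒⊑ (∨-assoc s t u)   = ∨L (∨L (∨R₁ (⊑-refl s)) (∨R₂ (∨R₁ (⊑-refl t)))) (∨R₂ (∨R₂ (⊑-refl u)))
    ~⇒⊑ (∧-assoc s t u)   = ∧R (∧L₁ (∧L₁ (⊑-refl s))) (∧R (∧L₁ (∧L₂ (⊑-refl t))) (∧L₂ (⊑-refl u)))
    ~⇒⊑ (∨-absorbs-∧ s t) = ∨L (⊑-refl s) (∧L₁ (⊑-refl s))
    ~⇒⊑ (∧-absorbs-∨ s t) = ∧L₁ (⊑-refl s)

    ~⇒⊒ : ∀ {s t} → s ~ t → t ⊑ s
    ~⇒⊒ ~refl             = ⊑-refl _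
    ~⇒⊒ (~sym e)          = ~⇒⊑ e
    ~⇒⊒ (~trans e f)      = ⊑-trans (~⇒⊒ f) (~⇒⊒ e)
    ~⇒⊒ (∨-cong e f)      = ∨L (∨R₁ (~⇒⊒ e)) (∨R₂ (~⇒⊒ f))
    ~⇒⊒ (∧-cong e f)      = ∧R (∧L₁ (~⇒⊒ e)) (∧L₂ (~⇒⊒ f))
    ~⇒⊒ (∨-comm s t)      = ∨L (∨R₂ (⊑-refl t)) (∨R₁ (⊑-refl s))
    ~⇒⊒ (∧-comm s t)      = ∧R (∧L₂ (⊑-refl s)) (∧L₁ (⊑-refl t))
    ~⇒⊒ (∨-assoc s t u)   = ∨L (∨R₁ (∨R₁ (⊑-refl s))) (∨L (∨R₁ (∨R₂ (⊑-refl t))) (∨R₂ (⊑-refl u)))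
    ~⇒⊒ (∧-assoc s t u)   = ∧R (∧R (∧L₁ (⊑-refl s)) (∧L₂ (∧L₁ (⊑-refl t)))) (∧L₂ (∧L₂ (⊑-refl u)))
    ~⇒⊒ (∨-absorbs-∧ s t) = ∨R₁ (⊑-refl s)
    ~⇒⊒ (∧-absorbs-∨ s t) = ∧R (⊑-refl s) (∨R₁ (⊑-refl s))

  module _ where
    open LatticeOrder (freeLattice X)

    ⊑⇒≤ : ∀ {s t} → s ⊑ t → s ≤ t
    ⊑⇒≤ ⊑-var    = ≤-refl
    ⊑⇒≤ (∨L p q) = ∨-least (⊑⇒≤ p) (⊑⇒≤ q)
    ⊑⇒≤ (∨R₁ p)  = ≤-trans (⊑⇒≤ p) (x≤x∨y _ _)
    ⊑⇒≤ (∨R₂ p)  = ≤-trans (⊑⇒≤ p) (y≤x∨y _ _)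
    ⊑⇒≤ (∧L₁ p)  = ≤-trans (x∧y≤x _ _) (⊑⇒≤ p)
    ⊑⇒≤ (∧L₂ p)  = ≤-trans (x∧y≤y _ _) (⊑⇒≤ p)
    ⊑⇒≤ (∧R p q) = ∧-greatest (⊑⇒≤ p) (⊑⇒≤ q)

    ≤⇒⊑ : ∀ {s t} → s ≤ t → s ⊑ t
    ≤⇒⊑ {s} {t} s≤t = ⊑-trans (~⇒⊑ s≤t) (∧L₂ (⊑-refl t))

    freeLattice-whitman : WhitmanCondition (freeLattice X)
    freeLattice-whitman s t u v st≤uv with ≤⇒⊑ st≤uv
    ... | ∨R₁ p = inj₂ (inj₁ (⊑⇒≤ p))
    ... | ∨R₂ p = inj₂ (inj₂ (⊑⇒≤ p))
    ... | ∧L₁ p = inj₁ (inj₁ (⊑⇒≤ p))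
    ... | ∧L₂ p = inj₁ (inj₂ (⊑⇒≤ p))

module _ {c ℓ} (L : Lattice c ℓ) where
  open Lattice L using (_∧_; _∨_)
  open LatticeOrder L using (_≤_)

  -- `h` preserves meets and joins and is injective up to the equivalences, so it preserves and
  -- reflects the order, and the alternatives of (W) pull back.
  sublatticeOfFree⇒whitman : SublatticeOfFree L → WhitmanCondition L
  sublatticeOfFree⇒whitman (X , emb) a b p q ab≤pq =
    Sum.map (Sum.map into-∨ into-∨) (Sum.map from-∧ from-∧)
      (freeLattice-whitman (h a) (h b) (h p) (h q)
        (≤-trans (≤-reflexive (~sym (h-∧ a b)))
          (≤-trans (~trans (h-cong ab≤pq) (h-∧ _ _)) (≤-reflexive (h-∨ p q)))))
    where
    open EmbedsInto emb
    open LatticeOrder (freeLattice X) using (≤-trans; ≤-reflexive) renaming (_≤_ to _≤F_)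

    h-reflects : ∀ {u v} → h u ≤F h v → u ≤ v
    h-reflects hu≤hv = h-inj (~trans hu≤hv (~sym (h-∧ _ _)))

    into-∨ : ∀ {u} → h u ≤F (h p ∨ₜ h q) → u ≤ p ∨ q
    into-∨ le = h-reflects (≤-trans le (≤-reflexive (~sym (h-∨ p q))))

    from-∧ : ∀ {u} → (h a ∧ₜ h b) ≤F h u → a ∧ b ≤ u
    from-∧ le = h-reflects (≤-trans (≤-reflexive (h-∧ a b)) le)

-- Inequalities of N5

N5-code : N5 → ℕ
N5-code 𝟎 = 0
N5-code x = 1
N5-code y = 2
N5-code z = 3
N5-code 𝟏 = 4

N5-decode : ℕ → N5
N5-decode 0 = 𝟎
N5-decode 1 = x
N5-decode 2 = y
N5-decode 3 = z
N5-decode _ = 𝟏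

N5-decode-code : ∀ v → N5-decode (N5-code v) ≡ v
N5-decode-code 𝟎 = refl
N5-decode-code x = refl
N5-decode-code y = refl
N5-decode-code z = refl
N5-decode-code 𝟏 = refl

-- Deciding equality on codes avoids a table of 25 cases, as `N5-decode` is a left inverse of
-- `N5-code`.
_≟₅_ : (u v : N5) → Dec (u ≡ v)
u ≟₅ v = map′
  (λ e → trans (sym (N5-decode-code u)) (trans (cong N5-decode e) (N5-decode-code v)))
  (cong N5-code) (N5-code u ℕ.≟ N5-code v)

all₅? : ∀ {p} {P : N5 → Set p} → (∀ v → Dec (P v)) → Dec (∀ v → P v)
all₅? P? = map′
  (λ { (p₀ , pˣ , pʸ , pᶻ , p₁) → λ { 𝟎 → p₀ ; x → pˣ ; y → pʸ ; z → pᶻ ; 𝟏 → p₁ } })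
  (λ p → p 𝟎 , p x , p y , p z , p 𝟏)
  (P? 𝟎 ×-dec P? x ×-dec P? y ×-dec P? z ×-dec P? 𝟏)

allVec₅? : ∀ {p} n {P : Vec N5 n → Set p} → (∀ v → Dec (P v)) → Dec (∀ v → P v)
allVec₅? zero    P? = map′ (λ { p [] → p }) (λ p → p []) (P? [])
allVec₅? (suc n) P? = map′ (λ { p (v ∷ vs) → p v vs }) (λ p v vs → p (v ∷ vs))
  (all₅? λ v → allVec₅? n λ vs → P? (v ∷ vs))

-- Indices beyond the length get the default value.
env : ∀ {a n} {A : Set a} → A → Vec A n → ℕ → A
env e []       _       = e
env e (v ∷ vs) zero    = v
env e (v ∷ vs) (suc i) = env e vs i

N5⊨? : ∀ n (s t : Term ℕ) → Dec (∀ (v : Vec N5 n) → eval₅ (env 𝟎 v) s ≡ eval₅ (env 𝟎 v) t)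
N5⊨? n s t = allVec₅? n λ v → eval₅ (env 𝟎 v) s ≟₅ eval₅ (env 𝟎 v) t

module N5-Inequalities {c ℓ} (L : Lattice c ℓ) (V : InVarietyN5 L) where
  open Lattice L using (_∧_; _∨_) renaming (sym to ≈-sym)
  open LatticeOrder L using (_≤_)

  private
    X₀ X₁ X₂ X₃ X₄ : Term ℕ
    X₀ = var 0
    X₁ = var 1
    X₂ = var 2
    X₃ = var 3
    X₄ = var 4

  weak-distributivity : ∀ a b c →
    c ∧ (a ∨ b) ≤ (c ∧ (a ∨ (c ∧ b))) ∨ (c ∧ (b ∨ (c ∧ a)))
  -- The inequality is the identity `s ∧ t ≈ s`, decided by enumerating all 125 assignments. Only
  -- variables 0, 1, 2 occur, so the default value of `env` is never read.
  weak-distributivity a b c = ≈-sym (V (s ∧ₜ t) s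
    (λ ρ → toWitness {a? = N5⊨? 3 (s ∧ₜ t) s} _ (ρ 0 ∷ ρ 1 ∷ ρ 2 ∷ []))
    (env a (a ∷ b ∷ c ∷ [])))
    where
    s = X₂ ∧ₜ (X₀ ∨ₜ X₁)
    t = (X₂ ∧ₜ (X₀ ∨ₜ (X₂ ∧ₜ X₁))) ∨ₜ (X₂ ∧ₜ (X₁ ∨ₜ (X₂ ∧ₜ X₀)))

  meet-of-joins : ∀ a b c →
    (a ∨ b) ∧ (a ∨ c) ≤ a ∨ ((b ∧ (a ∨ c)) ∨ (c ∧ (a ∨ b)))
  meet-of-joins a b c = ≈-sym (V (s ∧ₜ t) s
    (λ ρ → toWitness {a? = N5⊨? 3 (s ∧ₜ t) s} _ (ρ 0 ∷ ρ 1 ∷ ρ 2 ∷ []))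
    (env a (a ∷ b ∷ c ∷ [])))
    where
    s = (X₀ ∨ₜ X₁) ∧ₜ (X₀ ∨ₜ X₂)
    t = X₀ ∨ₜ ((X₁ ∧ₜ (X₀ ∨ₜ X₂)) ∨ₜ (X₂ ∧ₜ (X₀ ∨ₜ X₁)))

  -- Shaped for (W), with a meet of joins on the left and a join on the right. Note that
  -- `a ≤ a' ∨ b` holds exactly when `a ∧ (a' ∨ b)` is all of `a`.
  crossed-joins : ∀ a a' b b' →
    (a ∨ (b ∧ (b' ∨ a))) ∧ ((a ∧ (a' ∨ b)) ∨ b) ≤ (a ∧ (a' ∨ b)) ∨ (b ∧ (b' ∨ a))
  crossed-joins a a' b b' = ≈-sym (V (s ∧ₜ t) s
    (λ ρ → toWitness {a? = N5⊨? 4 (s ∧ₜ t) s} _ (ρ 0 ∷ ρ 1 ∷ ρ 2 ∷ ρ 3 ∷ []))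
    (env a (a ∷ a' ∷ b ∷ b' ∷ [])))
    where
    a″ = X₀ ∧ₜ (X₁ ∨ₜ X₂)
    b″ = X₂ ∧ₜ (X₃ ∨ₜ X₀)
    s = (X₀ ∨ₜ b″) ∧ₜ (a″ ∨ₜ X₂)
    t = a″ ∨ₜ b″

  -- If `a ≤ a' ∨ c` and `c ≤ c' ∨ b`, the left side is `a`; if also the meets on the right lie
  -- below `a'`, the right side is `a' ∨ c'`.
  nested-absorption : ∀ a a' b c c' →
    a ∧ (a' ∨ (c ∧ (c' ∨ b))) ≤ (a' ∨ c') ∨ ((a ∧ c) ∨ (b ∧ c))
  nested-absorption a a' b c c' = ≈-sym (V (s ∧ₜ t) s
    (λ ρ → toWitness {a? = N5⊨? 5 (s ∧ₜ t) s} _ (ρ 0 ∷ ρ 1 ∷ ρ 2 ∷ ρ 3 ∷ ρ 4 ∷ []))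
    (env a (a ∷ a' ∷ b ∷ c ∷ c' ∷ [])))
    where
    s = X₀ ∧ₜ (X₁ ∨ₜ (X₃ ∧ₜ (X₄ ∨ₜ X₂)))
    t = (X₁ ∨ₜ X₄) ∨ₜ ((X₀ ∧ₜ X₃) ∨ₜ (X₂ ∧ₜ X₃))

-- Elements with a common pairwise meet

module PairwiseMeets {c ℓ} (L : Lattice c ℓ) (V : InVarietyN5 L) (W : WhitmanCondition L)
  (d : Lattice.Carrier L) where

  open Lattice L using (Carrier; _≈_; _∧_; _∨_) renaming (sym to ≈-sym)
  open LatticeOrder L
  open N5-Inequalities L V

  MeetIn : Carrier → Carrier → Set ℓ
  MeetIn a b = (d ≤ a) × (d ≤ b) × (a ∧ b ≤ d)

  meetIn-sym : ∀ {a b} → MeetIn a b → MeetIn b a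
  meetIn-sym (d≤a , d≤b , ab≤d) = d≤b , d≤a , ≤-trans (∧-greatest (x∧y≤y _ _) (x∧y≤x _ _)) ab≤d

  meetIn-shrink : ∀ {a a' b} → MeetIn a b → d ≤ a' → a' ≤ a → MeetIn a' b
  meetIn-shrink (_ , d≤b , ab≤d) d≤a' a'≤a = d≤a' , d≤b , ≤-trans (∧-monotonic a'≤a ≤-refl) ab≤d

  meetIn-below : ∀ {a b e} → MeetIn a b → e ≤ a → e ≤ b → e ≤ d
  meetIn-below (_ , _ , ab≤d) e≤a e≤b = ≤-trans (∧-greatest e≤a e≤b) ab≤d

  -- Since `c ∧ b ≤ d ≤ a` and `c ∧ a ≤ d ≤ b`, the inner joins of `weak-distributivity` collapse to
  -- `a` and `b`.
  meetIn-∨ : ∀ {a b c} → MeetIn c a → MeetIn c b → MeetIn c (a ∨ b)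
  meetIn-∨ {a} {b} {c} (d≤c , d≤a , ca≤d) (_ , d≤b , cb≤d) =
    d≤c , ≤-trans d≤a (x≤x∨y a b) , ≤-trans (weak-distributivity a b c) (∨-least
      (≤-trans (∧-monotonic ≤-refl (∨-least ≤-refl (≤-trans cb≤d d≤a))) ca≤d)
      (≤-trans (∧-monotonic ≤-refl (∨-least ≤-refl (≤-trans ca≤d d≤b))) cb≤d))

  meet-of-joins-≤ : ∀ {a b c} → MeetIn a b → MeetIn a c → MeetIn b c → (a ∨ b) ∧ (a ∨ c) ≤ a
  meet-of-joins-≤ {a} {b} {c} ab@(d≤a , _) ac bc
    with meetIn-∨ (meetIn-sym ab) bc | meetIn-∨ (meetIn-sym ac) (meetIn-sym bc)
  ... | _ , _ , b[ac]≤d | _ , _ , c[ab]≤d =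
    ≤-trans (meet-of-joins a b c)
      (∨-least ≤-refl (∨-least (≤-trans b[ac]≤d d≤a) (≤-trans c[ab]≤d d≤a)))

  no-four : ∀ {a b c e} → ¬ a ≤ d → ¬ b ≤ d → ¬ c ≤ d → ¬ e ≤ d →
    MeetIn a b → MeetIn a c → MeetIn a e → MeetIn b c → MeetIn b e → MeetIn c e → ⊥
  no-four {a} {b} {c} {e} a≰d b≰d c≰d e≰d ab ac ae bc be ce =
    go (W (u ∨ c) (u ∨ e) a b (meet-of-joins-≤ (meetIn-sym cu) (meetIn-sym eu) ce))
    where
    u = a ∨ b
    cu = meetIn-∨ (meetIn-sym ac) (meetIn-sym bc)
    eu = meetIn-∨ (meetIn-sym ae) (meetIn-sym be)

    u≤ : u ≤ (u ∨ c) ∧ (u ∨ e)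
    u≤ = ∧-greatest (x≤x∨y _ _) (x≤x∨y _ _)

    go : (u ∨ c ≤ u ⊎ u ∨ e ≤ u) ⊎ ((u ∨ c) ∧ (u ∨ e) ≤ a ⊎ (u ∨ c) ∧ (u ∨ e) ≤ b) → ⊥
    -- Each alternative of (W) pushes one of the four elements below `d`: `c ≤ u`, `e ≤ u`, `b ≤ a`
    -- or `a ≤ b`.
    go (inj₁ (inj₁ uc≤u)) = c≰d (meetIn-below cu ≤-refl (≤-trans (y≤x∨y _ _) uc≤u))
    go (inj₁ (inj₂ ue≤u)) = e≰d (meetIn-below eu ≤-refl (≤-trans (y≤x∨y _ _) ue≤u))
    go (inj₂ (inj₁ p≤a))  = b≰d (meetIn-below ab (≤-trans (y≤x∨y _ _) (≤-trans u≤ p≤a)) ≤-refl)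
    go (inj₂ (inj₂ p≤b))  = a≰d (meetIn-below ab ≤-refl (≤-trans (x≤x∨y _ _) (≤-trans u≤ p≤b)))

  record Between (a a' : Carrier) : Set ℓ where
    field
      d≤a' : d ≤ a'
      a'≤a : a' ≤ a
      a'≰d : ¬ a' ≤ d
      a≰a' : ¬ a ≤ a'

    a≰d : ¬ a ≤ d
    a≰d a≤d = a≰a' (≤-trans a≤d d≤a')

  open Between

  -- (W) is applied to `crossed-joins`. Its first two alternatives give the two absorptions; in the
  -- others `b' ≤ a` or `a' ≤ b`, which puts `b'` or `a'` below `d`.
  absorption-total : ∀ {a a' b b'} → Between a a' → Between b b' → MeetIn a b →
    a ≤ a' ∨ b ⊎ b ≤ b' ∨ a
  absorption-total {a} {a'} {b} {b'} A B ab = go (W (a ∨ b″) (a″ ∨ b) a″ b″ (crossed-joins a a' b b'))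
    where
    a″ = a ∧ (a' ∨ b)
    b″ = b ∧ (b' ∨ a)

    a″b″≤a'b : a″ ∨ b″ ≤ a' ∨ b
    a″b″≤a'b = ∨-least (x∧y≤y _ _) (≤-trans (x∧y≤x _ _) (y≤x∨y _ _))

    a″b″≤b'a : a″ ∨ b″ ≤ b' ∨ a
    a″b″≤b'a = ∨-least (≤-trans (x∧y≤x _ _) (y≤x∨y _ _)) (x∧y≤y _ _)

    a'≤ : a' ≤ (a ∨ b″) ∧ (a″ ∨ b)
    a'≤ = ∧-greatest (≤-trans (a'≤a A) (x≤x∨y _ _))
                     (≤-trans (∧-greatest (a'≤a A) (x≤x∨y _ _)) (x≤x∨y _ _))

    b'≤ : b' ≤ (a ∨ b″) ∧ (a″ ∨ b)
    b'≤ = ∧-greatest (≤-trans (∧-greatest (a'≤a B) (x≤x∨y _ _)) (y≤x∨y _ _))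
                     (≤-trans (a'≤a B) (y≤x∨y _ _))

    go : (a ∨ b″ ≤ a″ ∨ b″ ⊎ a″ ∨ b ≤ a″ ∨ b″) ⊎
         ((a ∨ b″) ∧ (a″ ∨ b) ≤ a″ ⊎ (a ∨ b″) ∧ (a″ ∨ b) ≤ b″) → a ≤ a' ∨ b ⊎ b ≤ b' ∨ a
    go (inj₁ (inj₁ le)) = inj₁ (≤-trans (x≤x∨y _ _) (≤-trans le a″b″≤a'b))
    go (inj₁ (inj₂ le)) = inj₂ (≤-trans (y≤x∨y _ _) (≤-trans le a″b″≤b'a))
    go (inj₂ (inj₁ le)) = contradiction
      (meetIn-below ab (≤-trans b'≤ (≤-trans le (x∧y≤x _ _))) (a'≤a B)) (a'≰d B)
    go (inj₂ (inj₂ le)) = contradiction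
      (meetIn-below ab (a'≤a A) (≤-trans a'≤ (≤-trans le (x∧y≤x _ _)))) (a'≰d A)

  -- Shrinking `c` to `c'` keeps the pairwise meets, so `meet-of-joins-≤` applies with `c'` as the
  -- common joinand.
  not-absorbed-twice : ∀ {a b c c'} → Between c c' → MeetIn c a → MeetIn c b → MeetIn a b →
    c ≤ c' ∨ a → c ≤ c' ∨ b → ⊥
  not-absorbed-twice C ca cb ab c≤c'a c≤c'b = a≰a' C
    (≤-trans (∧-greatest c≤c'a c≤c'b)
      (meet-of-joins-≤ (meetIn-shrink ca (d≤a' C) (a'≤a C)) (meetIn-shrink cb (d≤a' C) (a'≤a C)) ab))

  not-absorbed-in-chain : ∀ {a a' b b' c c'} → Between a a' → Between b b' → Between c c' →
    MeetIn a b → MeetIn b c → MeetIn c a → a ≤ a' ∨ c → c ≤ c' ∨ b → ⊥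
  not-absorbed-in-chain {a} {a'} {b} {b'} {c} {c'} A B C ab bc ca a≤a'c c≤c'b =
    go (W (a ∨ b) (a ∨ c) a' c' (≤-trans (meet-of-joins-≤ ab (meetIn-sym ca) bc) a≤a'c'))
    where
    a≤a'c' : a ≤ a' ∨ c'
    a≤a'c' =
      ≤-trans (∧-greatest ≤-refl (≤-trans a≤a'c (∨-monotonic ≤-refl (∧-greatest ≤-refl c≤c'b))))
        (≤-trans (nested-absorption a a' b c c') (∨-least ≤-refl (≤-trans
          (∨-least (meetIn-below ca (x∧y≤y _ _) (x∧y≤x _ _)) (meetIn-below bc (x∧y≤x _ _) (x∧y≤y _ _)))
          (≤-trans (d≤a' A) (x≤x∨y _ _)))))

    a≤ : a ≤ (a ∨ b) ∧ (a ∨ c)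
    a≤ = ∧-greatest (x≤x∨y _ _) (x≤x∨y _ _)

    go : (a ∨ b ≤ a' ∨ c' ⊎ a ∨ c ≤ a' ∨ c') ⊎
         ((a ∨ b) ∧ (a ∨ c) ≤ a' ⊎ (a ∨ b) ∧ (a ∨ c) ≤ c') → ⊥
    -- The four alternatives give in turn `b ≤ a ∨ c`, hence `b ≤ d`; `c ≤ c' ∨ a`, a second
    -- absorption of `c`; `a ≤ a'`; and `a ≤ c`, hence `a ≤ d`.
    go (inj₁ (inj₁ le)) = a≰d B (meetIn-below (meetIn-∨ (meetIn-sym ab) bc) ≤-refl
      (≤-trans (y≤x∨y _ _) (≤-trans le (∨-monotonic (a'≤a A) (a'≤a C)))))
    go (inj₁ (inj₂ le)) = not-absorbed-twice C ca (meetIn-sym bc) ab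
      (≤-trans (y≤x∨y _ _) (≤-trans le
        (∨-least (≤-trans (a'≤a A) (y≤x∨y _ _)) (x≤x∨y _ _))))
      c≤c'b
    go (inj₂ (inj₁ le)) = a≰a' A (≤-trans a≤ le)
    go (inj₂ (inj₂ le)) = a≰d A (meetIn-below ca (≤-trans a≤ (≤-trans le (a'≤a C))) ≤-refl)

  -- Absorption orients each pair, giving a tournament on three vertices. Every case shows an
  -- element absorbed twice or two absorptions in a chain.
  no-three-between : ∀ {a a' b b' c c'} → Between a a' → Between b b' → Between c c' →
    MeetIn a b → MeetIn b c → MeetIn c a → ⊥
  no-three-between A B C ab bc ca
    with absorption-total A B ab | absorption-total B C bc | absorption-total C A ca
  ... | inj₁ a≤a'b | inj₁ b≤b'c | _          =
    not-absorbed-in-chain A C B (meetIn-sym ca) (meetIn-sym bc) (meetIn-sym ab) a≤a'b b≤b'c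
  ... | inj₁ a≤a'b | inj₂ c≤c'b | inj₁ c≤c'a =
    not-absorbed-twice C ca (meetIn-sym bc) ab c≤c'a c≤c'b
  ... | inj₁ a≤a'b | inj₂ c≤c'b | inj₂ a≤a'c =
    not-absorbed-twice A ab (meetIn-sym ca) bc a≤a'b a≤a'c
  ... | inj₂ b≤b'a | inj₁ b≤b'c | _          =
    not-absorbed-twice B (meetIn-sym ab) bc (meetIn-sym ca) b≤b'a b≤b'c
  ... | inj₂ b≤b'a | inj₂ c≤c'b | inj₁ c≤c'a =
    not-absorbed-twice C ca (meetIn-sym bc) ab c≤c'a c≤c'b
  ... | inj₂ b≤b'a | inj₂ c≤c'b | inj₂ a≤a'c =
    not-absorbed-in-chain A B C ab bc ca a≤a'c c≤c'b

  -- Constructively, failure to cover yields an intermediate element only under double negation.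
  -- This suffices, because `AtMost` is itself a negation.
  ¬covers⇒¬¬between : ∀ {a} → d ≤ a → ¬ a ≤ d → ¬ Covers L a d → ¬ ¬ Σ Carrier (Between a)
  ¬covers⇒¬¬between d≤a a≰d ¬cov ¬between = ¬cov
    ( (≈-sym d≤a , λ d≈a → a≰d (≤-reflexive (≈-sym d≈a)))
    , λ { (w , (d≤w , d≉w) , (w≤a , w≉a)) → ¬between (w , record
        { d≤a' = ≈-sym d≤w
        ; a'≤a = ≈-sym w≤a
        ; a'≰d = λ w≤d → d≉w (antisym (≈-sym d≤w) w≤d)
        ; a≰a' = λ a≤w → w≉a (antisym (≈-sym w≤a) a≤w)
        }) })

  module _ {p} {Y : Carrier → Set p} (antichain : Antichain L Y)
    (meets : ∀ a b → Y a → Y b → ¬ (a ≈ b) → a ∧ b ≈ d) where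

    distinct⇒meetIn : ∀ {a b} → Y a → Y b → ¬ (a ≈ b) → MeetIn a b
    distinct⇒meetIn {a} {b} Ya Yb a≉b =
      ≤-trans (≤-reflexive (≈-sym ab≈d)) (x∧y≤x a b) ,
      ≤-trans (≤-reflexive (≈-sym ab≈d)) (x∧y≤y a b) ,
      ≤-reflexive ab≈d
      where ab≈d = meets a b Ya Yb a≉b

    -- From `a ≤ d` would follow `a ≤ d ≤ b`, so `a ≈ b` by the antichain condition.
    distinct⇒≰d : ∀ {a b} → Y a → Y b → ¬ (a ≈ b) → ¬ a ≤ d
    distinct⇒≰d {a} {b} Ya Yb a≉b a≤d with distinct⇒meetIn Ya Yb a≉b
    ... | _ , d≤b , _ = a≉b (antichain a b Ya Yb (≈-sym (≤-trans a≤d d≤b)))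

    atMost-three : AtMost L 3 Y
    atMost-three (f , Yf , inj) = no-four
      (≰d (# 0) (# 1) λ ()) (≰d (# 1) (# 0) λ ()) (≰d (# 2) (# 0) λ ()) (≰d (# 3) (# 0) λ ())
      (meetIn (# 0) (# 1) λ ()) (meetIn (# 0) (# 2) λ ()) (meetIn (# 0) (# 3) λ ())
      (meetIn (# 1) (# 2) λ ()) (meetIn (# 1) (# 3) λ ()) (meetIn (# 2) (# 3) λ ())
      where
      ≰d : ∀ i j → ¬ (i ≡ j) → ¬ f i ≤ d
      ≰d i j i≢j = distinct⇒≰d (Yf i) (Yf j) (λ e → i≢j (inj i j e))

      meetIn : ∀ i j → ¬ (i ≡ j) → MeetIn (f i) (f j)
      meetIn i j i≢j = distinct⇒meetIn (Yf i) (Yf j) (λ e → i≢j (inj i j e))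

    atMost-two-noncovers : AtMost L 2 (λ a → Y a × ¬ Covers L a d)
    atMost-two-noncovers (f , Yf , inj) =
      between (# 0) (# 1) (λ ()) λ (_ , A) →
      between (# 1) (# 2) (λ ()) λ (_ , B) →
      between (# 2) (# 0) (λ ()) λ (_ , C) →
      no-three-between A B C
        (meetIn (# 0) (# 1) (λ ())) (meetIn (# 1) (# 2) (λ ())) (meetIn (# 2) (# 0) (λ ()))
      where
      meetIn : ∀ i j → ¬ (i ≡ j) → MeetIn (f i) (f j)
      meetIn i j i≢j = distinct⇒meetIn (proj₁ (Yf i)) (proj₁ (Yf j)) (λ e → i≢j (inj i j e))

      between : ∀ i j → ¬ (i ≡ j) → ¬ ¬ Σ Carrier (Between (f i))
      between i j i≢j = ¬covers⇒¬¬between (proj₁ (meetIn i j i≢j))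
        (distinct⇒≰d (proj₁ (Yf i)) (proj₁ (Yf j)) (λ e → i≢j (inj i j e)))
        (proj₂ (Yf i))

-- Duality

-- The order-reversing symmetry of the pentagon: upside down, the chain `y < z` is reversed and `x`
-- stays fixed.
δ : N5 → N5
δ 𝟎 = 𝟏
δ x = x
δ y = z
δ z = y
δ 𝟏 = 𝟎

δ-involutive : ∀ u → δ (δ u) ≡ u
δ-involutive = toWitness {a? = all₅? λ u → δ (δ u) ≟₅ u} _

δ-∨ : ∀ u v → δ (u ∨₅ v) ≡ δ u ∧₅ δ v
δ-∨ = toWitness {a? = all₅? λ u → all₅? λ v → δ (u ∨₅ v) ≟₅ (δ u ∧₅ δ v)} _

δ-∧ : ∀ u v → δ (u ∧₅ v) ≡ δ u ∨₅ δ v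
δ-∧ = toWitness {a? = all₅? λ u → all₅? λ v → δ (u ∧₅ v) ≟₅ (δ u ∨₅ δ v)} _

dual : ∀ {a} {X : Set a} → Term X → Term X
dual (var i)  = var i
dual (s ∨ₜ t) = dual s ∧ₜ dual t
dual (s ∧ₜ t) = dual s ∨ₜ dual t

eval₅-dual : ∀ ρ s → eval₅ ρ (dual s) ≡ δ (eval₅ (λ i → δ (ρ i)) s)
eval₅-dual ρ (var i)  = sym (δ-involutive (ρ i))
eval₅-dual ρ (s ∨ₜ t) = trans (cong₂ _∧₅_ (eval₅-dual ρ s) (eval₅-dual ρ t))
  (sym (δ-∨ (eval₅ _ s) (eval₅ _ t)))
eval₅-dual ρ (s ∧ₜ t) = trans (cong₂ _∨₅_ (eval₅-dual ρ s) (eval₅-dual ρ t))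
  (sym (δ-∧ (eval₅ _ s) (eval₅ _ t)))

-- The given identity at the assignment `δ ∘ ρ`, mapped through `δ`, is the dual identity at `ρ`.
N5⊨-dual : ∀ s t → N5⊨ s t → N5⊨ (dual s) (dual t)
N5⊨-dual s t s≈t ρ = trans (eval₅-dual ρ s)
  (trans (cong δ (s≈t (λ i → δ (ρ i)))) (sym (eval₅-dual ρ t)))

module Dual {c ℓ} (L : Lattice c ℓ) where
  open Lattice L using (Carrier; _≈_; _∧_; _∨_)
    renaming (refl to ≈-refl; sym to ≈-sym; trans to ≈-trans; ∨-cong to ∨L-cong; ∧-cong to ∧L-cong)
  open LatticeProperties L using (∧-∨-lattice)
  open LatticeOrder L using (_≤_; antisym; x≤x∨y; y≤x∨y; ∨-least; ≤-refl; ≤-trans; ≤-reflexive)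
  open LatticeOrder ∧-∨-lattice using () renaming (_≤_ to _≤ᵒ_)

  Lᵒ : Lattice c ℓ
  Lᵒ = ∧-∨-lattice

  ≤⇒≤ᵒ : ∀ {a b} → a ≤ b → b ≤ᵒ a
  ≤⇒≤ᵒ a≤b = antisym (x≤x∨y _ _) (∨-least ≤-refl a≤b)

  ≤ᵒ⇒≤ : ∀ {a b} → a ≤ᵒ b → b ≤ a
  ≤ᵒ⇒≤ a≤ᵒb = ≤-trans (y≤x∨y _ _) (≤-reflexive (≈-sym a≤ᵒb))

  -- Reversing the order exchanges the pairs `a , b` and `p , q`, and with them the two pairs of
  -- alternatives; hence `Sum.swap`.
  whitman-dual : WhitmanCondition L → WhitmanCondition Lᵒ
  whitman-dual W a b p q le =
    Sum.swap (Sum.map (Sum.map ≤⇒≤ᵒ ≤⇒≤ᵒ) (Sum.map ≤⇒≤ᵒ ≤⇒≤ᵒ) (W p q a b (≤ᵒ⇒≤ le)))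

  evalL-dual : ∀ ρ s → evalL L ρ (dual s) ≈ evalL Lᵒ ρ s
  evalL-dual ρ (var i)  = ≈-refl
  evalL-dual ρ (s ∨ₜ t) = ∧L-cong (evalL-dual ρ s) (evalL-dual ρ t)
  evalL-dual ρ (s ∧ₜ t) = ∨L-cong (evalL-dual ρ s) (evalL-dual ρ t)

  inVarietyN5-dual : InVarietyN5 L → InVarietyN5 Lᵒ
  inVarietyN5-dual V s t s≈t ρ = ≈-trans (≈-sym (evalL-dual ρ s))
    (≈-trans (V (dual s) (dual t) (N5⊨-dual s t s≈t) ρ) (evalL-dual ρ t))

  antichain-dual : ∀ {p} {Y : Carrier → Set p} → Antichain L Y → Antichain Lᵒ Y
  antichain-dual anti a b Ya Yb a≤ᵒb =
    ≈-sym (anti b a Yb Ya (≈-sym (≤ᵒ⇒≤ (≈-sym a≤ᵒb))))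

  <⇒<ᵒ : ∀ {a b} → _<L_ L a b → _<L_ Lᵒ b a
  <⇒<ᵒ (a≤b , a≉b) = ≈-sym (≤⇒≤ᵒ (≈-sym a≤b)) , λ b≈a → a≉b (≈-sym b≈a)

  <ᵒ⇒< : ∀ {a b} → _<L_ Lᵒ a b → _<L_ L b a
  <ᵒ⇒< (a≤ᵒb , a≉b) = ≈-sym (≤ᵒ⇒≤ (≈-sym a≤ᵒb)) , λ b≈a → a≉b (≈-sym b≈a)

  covers-dual : ∀ {a b} → Covers Lᵒ a b → Covers L b a
  covers-dual (b<ᵒa , none) =
    <ᵒ⇒< b<ᵒa , λ { (w , a<w , w<b) → none (w , <⇒<ᵒ w<b , <⇒<ᵒ a<w) }

theorem4p1 : ∀ {c ℓ p} (L : Lattice c ℓ) → InVarietyN5 L → SublatticeOfFree L →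
    (Y : Lattice.Carrier L → Set p) → Antichain L Y →
    ((d : Lattice.Carrier L) →
    (∀ a b → Y a → Y b → ¬ Lattice._≈_ L a b → Lattice._≈_ L (Lattice._∧_ L a b) d) →
    AtMost L 3 Y × AtMost L 2 (λ a → Y a × ¬ Covers L a d))
    ×
    ((d : Lattice.Carrier L) →
    (∀ a b → Y a → Y b → ¬ Lattice._≈_ L a b → Lattice._≈_ L (Lattice._∨_ L a b) d) →
    AtMost L 3 Y × AtMost L 2 (λ a → Y a × ¬ Covers L d a))
theorem4p1 L V F Y anti =
  (λ d meets → let open PairwiseMeets L V W d in
    atMost-three anti meets , atMost-two-noncovers anti meets) ,
  -- The meet of `Lᵒ` is by definition the join of `L`, so `joins` serves as the hypothesis on
  -- meets.
  (λ d joins → let open PairwiseMeets Lᵒ (inVarietyN5-dual V) (whitman-dual W) d in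
    atMost-three (antichain-dual anti) joins ,
    λ { (f , Yf , inj) → atMost-two-noncovers (antichain-dual anti) joins
      (f , (λ i → let Yi , ¬cov = Yf i in Yi , λ cov → ¬cov (covers-dual cov)) , inj) })
  where
  open Dual L
  W = sublatticeOfFree⇒whitman L F
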